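{- Let $k\ge 1$ and $n\ge 1$ be integers. The $(k+1)$-tuples of statistics $(\mathrm{pk}_0,\mathrm{pk}_1,\dots,\mathrm{pk}_{k-1},\mathrm{dd})$ on $\mathcal{P}^k_n$ and $(e_1,e_2,\dots,e_{k+1})$ on $\mathcal{T}^{k+1}_n$ are (jointly) equidistributed. That is, for all nonnegative integers $r_0,\dots,r_k$, the number of $P\in\mathcal{P}^k_n$ with $(\mathrm{pk}_0,\dots,\mathrm{pk}_{k-1},\mathrm{dd})(P)=(r_0,\dots,r_k)$ equals the number of $T\in\mathcal{T}^{k+1}_n$ with $(e_1,\dots,e_{k+1})(T)=(r_0,\dots,r_k)$.
   Context: A $k$-Dyck path of down-size $n$ is a lattice path from $(0,0)$ to $((k+1)n,0)$ with steps $u=(1,1)$ and $d=(1,-k)$ that stays in the first quadrant (never goes below the $x$-axis). $\mathcal{P}^k_n$ is the set of all such paths. A peak is a block of two consecutive steps $ud$; its height is the second coordinate of the left endpoint of its $d$ step. A double descent is a block $dd$ of two consecutive steps. For $0\le i\le k-1$, $\mathrm{pk}_i(P)$ is the number of non-rightmost peaks of $P$ (all peaks except the last one) whose height is congruent to $i$ modulo $k$; $\mathrm{dd}(P)$ is the number of double descents of $P$. An $l$-ary tree is a rooted ordered tree in which each node has at most $l$ children, which are assigned distinct positions in $\{1,\dots,l\}$ from left to right, not necessarily consecutive. $\mathcal{T}^l_n$ is the set of $l$-ary trees with $n$ vertices. For $1\le i\le l$, $e_i(T)$ is the number of nodes of $T$ that are children in position $i$ (of their parent). -}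

module Defs where

open import Data.Fin using (Fin; toℕ)
open import Data.Integer as ℤ using (ℤ; +_; 0ℤ; 1ℤ)
open import Data.Integer.Divisibility.Signed using (_∣_; _∣?_)
open import Data.List using (List; []; _∷_; filter; foldl; length)
open import Data.List.Relation.Unary.All using (All)
open import Data.Maybe using (Maybe; just; nothing)
open import Data.Nat using (ℕ; suc; _+_; _*_)
open import Data.Product using (_×_; _,_; proj₂)
open import Data.Refinement using (Refinement-syntax)
open import Data.Vec using (Vec; []; _∷_; _∷ʳ_; lookup; tabulate)
open import Function.Bundles using (_↔_)
open import Relation.Binary.PropositionalEquality using (_≡_)
open import Relation.Nullary using (Dec)

-- Propositional equality is the right notion of sameness for every type
-- counted below: the defining conditions are proof-irrelevant refinements.
HasCardinality : Set → ℕ → Set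
HasCardinality A N = A ↔ Fin N

------------------------------------------------------------------------
-- k-Dyck paths

data Step : Set where
  u d : Step

Point : Set
Point = ℤ × ℤ

origin : Point
origin = 0ℤ , 0ℤ

move : ℕ → Point → Step → Point
move k (x , y) u = x ℤ.+ 1ℤ , y ℤ.+ 1ℤ
move k (x , y) d = x ℤ.+ 1ℤ , y ℤ.- + k

vertices : ℕ → Point → List Step → List Point
vertices k p []      = p ∷ []
vertices k p (s ∷ w) = p ∷ vertices k (move k p s) w

InFirstQuadrant : Point → Set
InFirstQuadrant (x , y) = 0ℤ ℤ.≤ x × 0ℤ ℤ.≤ y

IsDyckPath : ℕ → ℕ → List Step → Set
IsDyckPath k n w =
  All InFirstQuadrant (vertices k origin w) ×
  foldl (move k) origin w ≡ (+ (suc k * n) , 0ℤ)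

DyckPath : ℕ → ℕ → Set
DyckPath k n = [ w ∈ List Step ∣ IsDyckPath k n w ]

-- Heights of the peaks, from left to right, of the path with steps w
-- that starts at p.
peakHeights : ℕ → Point → List Step → List ℤ
peakHeights k p []          = []
peakHeights k p (u ∷ d ∷ w) =
  proj₂ (move k p u) ∷ peakHeights k (move k (move k p u) d) w
peakHeights k p (u ∷ u ∷ w) = peakHeights k (move k p u) (u ∷ w)
peakHeights k p (u ∷ [])    = []
peakHeights k p (d ∷ w)     = peakHeights k (move k p d) w

dropLast : ∀ {A : Set} → List A → List A
dropLast []           = []
dropLast (_ ∷ [])     = []
dropLast (x ∷ y ∷ xs) = x ∷ dropLast (y ∷ xs)

_≡_mod_ : ℤ → ℕ → ℕ → Set
h ≡ i mod k = + k ∣ h ℤ.- + i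

_≡?_mod_ : ∀ h i k → Dec (h ≡ i mod k)
h ≡? i mod k = + k ∣? h ℤ.- + i

pk : ℕ → ℕ → List Step → ℕ
pk k i w =
  length (filter (λ h → h ≡? i mod k) (dropLast (peakHeights k origin w)))

dd : List Step → ℕ
dd []          = 0
dd (d ∷ d ∷ w) = suc (dd (d ∷ w))
dd (d ∷ u ∷ w) = dd (u ∷ w)
dd (d ∷ [])    = 0
dd (u ∷ w)     = dd w

-- (pk₀ , … , pkₖ₋₁ , dd)
pathStatistics : ∀ k → List Step → Vec ℕ (suc k)
pathStatistics k w = tabulate {n = k} (λ i → pk k (toℕ i) w) ∷ʳ dd w

------------------------------------------------------------------------
-- l-ary trees

-- Entry i of the vector is the child in that position, if there is one.
data Tree (l : ℕ) : Set where
  node : Vec (Maybe (Tree l)) l → Tree l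

module _ {l : ℕ} where

  mutual

    size : Tree l → ℕ
    size (node cs) = suc (sizes cs)

    sizes : ∀ {m} → Vec (Maybe (Tree l)) m → ℕ
    sizes []             = 0
    sizes (nothing ∷ cs) = sizes cs
    sizes (just t ∷ cs)  = size t + sizes cs

  occupied : Maybe (Tree l) → ℕ
  occupied nothing  = 0
  occupied (just _) = 1

  mutual

    -- Positions are numbered from 0, so  e i  is the statistic written e_{i+1}.
    e : Fin l → Tree l → ℕ
    e i (node cs) = occupied (lookup cs i) + es i cs

    es : ∀ {m} → Fin l → Vec (Maybe (Tree l)) m → ℕ
    es i []             = 0
    es i (nothing ∷ cs) = es i cs
    es i (just t ∷ cs)  = e i t + es i cs

TreeOfSize : ℕ → ℕ → Set
TreeOfSize l n = [ t ∈ Tree l ∣ size t ≡ n ]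

-- (e₁ , … , eₗ)
treeStatistics : ∀ {l} → Tree l → Vec ℕ l
treeStatistics t = tabulate (λ i → e i t)

{-# OPTIONS --safe #-}
module Submission where

-- A nonempty k-Dyck path factors uniquely as A₀ u A₁ u ⋯ u Aₖ d with every Aᵢ
-- a possibly empty k-Dyck path.  Cutting recursively makes it a (k+1)-ary
-- tree with one node per d step.  The last child Aₖ exists exactly when
-- the final d completes a double descent, so dd counts the children in the
-- last position; when Aₖ is empty, the final d closes a peak, k above the
-- base of the factor.  The height of that peak modulo k is therefore the
-- height of the base of the factor modulo k, and the base of Aᵢ lies i above
-- that of its parent.
--
-- To turn residues into positions, the children are placed in cyclic order:
-- a factor Aᵢ with i < k whose base has height h in the whole path becomes
-- the child in position h mod k (counted from 0), and Aₖ stays last.  Follow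
-- last children from any node until there are no more: this chain ends in
-- one peak, whose residue is that of the base of its topmost node.  So for
-- i < k the peaks with residue i correspond to the children in position i,
-- except for the peak of the chain that starts at the root, which is the last
-- peak of the path.
--
-- Here word maps a tree to its path, and treeOf, a shift-reduce parser,
-- inverts it (treeOf-word, word-treeOf).  The cyclic placement is a rotation
-- of a vector by the base height, so no division is needed: a sum of
-- contributions that are k-periodic in the height does not see the rotation
-- (total-toSlots).  This gives the statistics of a tree in terms of its
-- factors (e-build, e-build-last), and childInduction carries them to words
-- (pk-word, dd-word, collected in statistics-word).  Finiteness is clear on
-- the side of paths, a decidable set of words of one length (words-finite).

open import Defs
open import Data.Nat using (ℕ; suc; _≥_)
open import Data.Product using (_×_; ∃-syntax)
open import Data.Refinement using (Refinement-syntax; value)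
open import Data.Vec using (Vec)
open import Relation.Binary.PropositionalEquality using (_≡_)

open import Data.Empty using (⊥-elim)
open import Data.Fin using (Fin; zero; suc; toℕ; fromℕ; inject₁)
open import Data.Fin.Properties using (toℕ<n)
open import Data.Integer as ℤ using (ℤ; +_; 0ℤ; 1ℤ; +≤+)
open import Data.Integer.Divisibility.Signed
  using (_∣_; ∣-refl; ∣⇒∣ᵤ; ∣m∣n⇒∣m+n; ∣m+n∣m⇒∣n; divides)
import Data.Integer.Properties as ℤ
open import Data.Irrelevant using ([_])
open import Data.List using (List; []; _∷_; _++_; length; filter; foldl)
import Data.List as List
open import Data.List.Membership.Propositional using (_∈_)
open import Data.List.Membership.Propositional.Properties
  using (∈-map⁺; ∈-map⁻; ∈-++⁺ˡ; ∈-++⁺ʳ; ∈-filter⁺; ∈-filter⁻; ∈-lookup)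
import Data.List.Properties as List
open import Data.List.Relation.Unary.All as ListAll using ([]; _∷_)
import Data.List.Relation.Unary.AllPairs as AllPairs
open import Data.List.Relation.Unary.Any using (here; index)
open import Data.List.Relation.Unary.Any.Properties using (lookup-index)
open import Data.List.Relation.Unary.Unique.Propositional using (Unique)
import Data.List.Relation.Unary.Unique.Propositional.Properties as Unique
open import Data.Maybe using (Maybe; just; nothing; fromMaybe)
open import Data.Nat using (>-nonZero; zero; _+_; _*_; _∸_; _≤_; _<_; z≤n; s≤s)
open import Data.Nat.Divisibility using (>⇒∤) renaming (_∣_ to _∣ₙ_)
open import Data.Nat.Properties
open import Data.Nat.Tactic.RingSolver using (solve-∀)
open import Data.Product using (_,_; proj₁; proj₂; ∃₂)
import Data.Product.Properties as Product
open import Data.Refinement using (_,_; value-injective)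
open import Data.Vec using ([]; _∷_; _∷ʳ_; map; replicate; lookup; tabulate; init; last; initLast)
import Data.Vec.Properties as Vec
open import Data.Vec.Relation.Unary.All using (All; []; _∷_)
open import Data.Sum using (_⊎_; inj₁; inj₂)
open import Function using (_∘_; _↔_; mk↔ₛ′)
open import Function.Construct.Composition using (_↔-∘_)
open import Relation.Binary.Definitions using (DecidableEquality)
open import Relation.Binary.PropositionalEquality
  using (_≢_; refl; sym; trans; cong; cong₂; subst; module ≡-Reasoning)
open import Relation.Nullary using (yes; no; ¬_)
open import Relation.Nullary.Decidable using (recompute; _×-dec_)
open import Relation.Unary using (Decidable)

private
  variable
    A B : Set
    m : ℕ

------------------------------------------------------------------------
-- Finiteness of decidable sets of words of fixed length

_≟ₛ_ : DecidableEquality Step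
u ≟ₛ u = yes refl
u ≟ₛ d = no λ ()
d ≟ₛ u = no λ ()
d ≟ₛ d = yes refl

lookup-injective : {xs : List A} → Unique xs → ∀ {i j} →
  List.lookup xs i ≡ List.lookup xs j → i ≡ j
lookup-injective (_ AllPairs.∷ _) {zero} {zero} _ = refl
lookup-injective {xs = _ ∷ xs} (x∉ AllPairs.∷ _) {zero} {suc j} eq =
  ⊥-elim (ListAll.lookup x∉ (∈-lookup {xs = xs} j) eq)
lookup-injective {xs = _ ∷ xs} (x∉ AllPairs.∷ _) {suc i} {zero} eq =
  ⊥-elim (ListAll.lookup x∉ (∈-lookup {xs = xs} i) (sym eq))
lookup-injective (_ AllPairs.∷ uniq) {suc i} {suc j} eq =
  cong suc (lookup-injective uniq eq)

words-of-length : ℕ → List (List Step)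
words-of-length zero    = [] ∷ []
words-of-length (suc m) =
  List.map (u ∷_) (words-of-length m) ++ List.map (d ∷_) (words-of-length m)

words-of-length-complete : ∀ w → w ∈ words-of-length (length w)
words-of-length-complete []      = here refl
words-of-length-complete (u ∷ w) = ∈-++⁺ˡ (∈-map⁺ (u ∷_) (words-of-length-complete w))
words-of-length-complete (d ∷ w) =
  ∈-++⁺ʳ (List.map (u ∷_) (words-of-length (length w)))
         (∈-map⁺ (d ∷_) (words-of-length-complete w))

words-of-length-unique : ∀ m → Unique (words-of-length m)
words-of-length-unique zero    = ListAll.[] AllPairs.∷ AllPairs.[]
words-of-length-unique (suc m) =
  Unique.++⁺ (Unique.map⁺ List.∷-injectiveʳ (words-of-length-unique m))
             (Unique.map⁺ List.∷-injectiveʳ (words-of-length-unique m))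
             disjoint
  where
  disjoint : ∀ {w} → ¬ (w ∈ List.map (u ∷_) (words-of-length m) ×
                        w ∈ List.map (d ∷_) (words-of-length m))
  disjoint (p , q) with ∈-map⁻ (u ∷_) p | ∈-map⁻ (d ∷_) q
  ... | _ , _ , refl | _ , _ , ()

words-finite : {P : List Step → Set} → Decidable P →
  ∀ L → (∀ {w} → P w → length w ≡ L) →
  ∃[ N ] HasCardinality [ w ∈ List Step ∣ P w ] N
words-finite {P} P? L P⇒length = length ws , mk↔ₛ′ to from to∘from from∘to
  where
  ws : List (List Step)
  ws = filter P? (words-of-length L)

  member : ∀ {w} → P w → w ∈ ws
  member {w} p = ∈-filter⁺ P?
    (subst (λ l → w ∈ words-of-length l) (P⇒length p) (words-of-length-complete w)) p

  to : [ w ∈ List Step ∣ P w ] → Fin (length ws)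
  to (w , [ p ]) = index (member (recompute (P? w) p))

  from : Fin (length ws) → [ w ∈ List Step ∣ P w ]
  from i = List.lookup ws i , [ proj₂ (∈-filter⁻ P? {xs = words-of-length L} (∈-lookup {xs = ws} i)) ]

  from∘to : ∀ x → from (to x) ≡ x
  from∘to (w , [ p ]) = value-injective (sym (lookup-index (member (recompute (P? w) p))))

  to∘from : ∀ i → to (from i) ≡ i
  to∘from i = lookup-injective (Unique.filter⁺ P? (words-of-length-unique L))
    (cong value (from∘to (from i)))

------------------------------------------------------------------------
-- Sums along a vector and rotations

-- The sum f y v₀ + f (y + 1) v₁ + f (y + 2) v₂ + ⋯ .
total : (ℕ → A → ℕ) → ℕ → Vec A m → ℕ
total f y []      = 0
total f y (x ∷ v) = f y x + total f (suc y) v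

total-∷ʳ : (f : ℕ → A → ℕ) (y : ℕ) (v : Vec A m) (x : A) →
  total f y (v ∷ʳ x) ≡ total f y v + f (m + y) x
total-∷ʳ f y [] x = +-identityʳ _
total-∷ʳ {m = suc m} f y (x′ ∷ v) x
  rewrite total-∷ʳ f (suc y) v x | +-suc m y = sym (+-assoc (f y x′) _ _)

total-+ : (f g : ℕ → A → ℕ) (y : ℕ) (v : Vec A m) →
  total (λ h x → f h x + g h x) y v ≡ total f y v + total g y v
total-+ f g y []      = refl
total-+ f g y (x ∷ v) rewrite total-+ f g (suc y) v = interchange (f y x) (g y x) _ _
  where
  interchange : ∀ a b c e → a + b + (c + e) ≡ a + c + (b + e)
  interchange = solve-∀

total-zero : (f : ℕ → A → ℕ) (y : ℕ) (v : Vec A m) →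
  (∀ h x → y ≤ h → h < m + y → f h x ≡ 0) → total f y v ≡ 0
total-zero f y [] zeros = refl
total-zero {m = suc m} f y (x ∷ v) zeros
  rewrite zeros y x ≤-refl (s≤s (m≤n+m y m)) =
  total-zero f (suc y) v λ h x p q →
    zeros h x (<⇒≤ p) (subst (h <_) (+-suc m y) q)

-- If f vanishes at every height of the range but that of entry i, the sum
-- reduces to entry i.
total-single : (f : ℕ → A → ℕ) (y : ℕ) (v : Vec A m) (i : Fin m) →
  (∀ h x → h < m + y → h ≢ toℕ i + y → f h x ≡ 0) →
  total f y v ≡ f (toℕ i + y) (lookup v i)
total-single {m = suc m} f y (x ∷ v) zero zeros =
  trans (cong (λ s → f y x + s) (total-zero f (suc y) v λ h x p q →
          zeros h x (subst (h <_) (+-suc m y) q) λ h≡y → <-irrefl (sym h≡y) p))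
        (+-identityʳ _)
total-single {m = suc m} f y (x ∷ v) (suc i) zeros
  rewrite zeros y x (s≤s (m≤n+m y m)) (λ y≡ → <-irrefl y≡ (s≤s (m≤n+m y (toℕ i))))
        | total-single f (suc y) v i (λ h x p q →
            zeros h x (subst (h <_) (+-suc m y) p)
                      λ eq → q (trans eq (sym (+-suc (toℕ i) y))))
        | +-suc (toℕ i) y = refl

rotateˡ : Vec A (suc m) → Vec A (suc m)
rotateˡ (x ∷ v) = v ∷ʳ x

rotateʳ : Vec A (suc m) → Vec A (suc m)
rotateʳ v = last v ∷ init v

rotateˡ-rotateʳ : (v : Vec A (suc m)) → rotateˡ (rotateʳ v) ≡ v
rotateˡ-rotateʳ v = sym (proj₂ (proj₂ (initLast v)))

rotateʳ-rotateˡ : (v : Vec A (suc m)) → rotateʳ (rotateˡ v) ≡ v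
rotateʳ-rotateˡ (x ∷ v) = cong₂ _∷_ (Vec.last-∷ʳ x v) (Vec.init-∷ʳ x v)

-- A vector in slot order lists children by position; a vector in path order
-- lists them from left to right along the path, the first one at height y.
-- Entry i of  fromSlots y v  is entry (y + i) mod m of a vector v of length
-- m, and toSlots is the inverse rearrangement.
fromSlots : ℕ → Vec A (suc m) → Vec A (suc m)
fromSlots zero    v = v
fromSlots (suc y) v = rotateˡ (fromSlots y v)

toSlots : ℕ → Vec A (suc m) → Vec A (suc m)
toSlots zero    v = v
toSlots (suc y) v = toSlots y (rotateʳ v)

toSlots-fromSlots : ∀ y (v : Vec A (suc m)) → toSlots y (fromSlots y v) ≡ v
toSlots-fromSlots zero    v = refl
toSlots-fromSlots (suc y) v
  rewrite rotateʳ-rotateˡ (fromSlots y v) = toSlots-fromSlots y v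

fromSlots-toSlots : ∀ y (v : Vec A (suc m)) → fromSlots y (toSlots y v) ≡ v
fromSlots-toSlots zero    v = refl
fromSlots-toSlots (suc y) v
  rewrite fromSlots-toSlots y (rotateʳ v) = rotateˡ-rotateʳ v

map-fromSlots : (f : A → B) → ∀ y (v : Vec A (suc m)) →
  map f (fromSlots y v) ≡ fromSlots y (map f v)
map-fromSlots f zero    v = refl
map-fromSlots f (suc y) v = trans (map-rotateˡ (fromSlots y v)) (cong rotateˡ (map-fromSlots f y v))
  where
  map-rotateˡ : ∀ {m} (v : Vec _ (suc m)) → map f (rotateˡ v) ≡ rotateˡ (map f v)
  map-rotateˡ (x ∷ v) = Vec.map-∷ʳ f x v

-- One rotation removes the entry at height y and appends it at height y + m,
-- m the length, where a function of period m takes the same value.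
total-fromSlots : (f : ℕ → A → ℕ) → (∀ h x → f (suc m + h) x ≡ f h x) →
  ∀ y (v : Vec A (suc m)) → total f y (fromSlots y v) ≡ total f 0 v
total-fromSlots f periodic zero    v = refl
total-fromSlots {m = m} f periodic (suc y) v =
  trans (total-rotateˡ (fromSlots y v)) (total-fromSlots f periodic y v)
  where
  total-rotateˡ : ∀ (v : Vec _ (suc m)) → total f (suc y) (rotateˡ v) ≡ total f y v
  total-rotateˡ (x ∷ v)
    rewrite total-∷ʳ f (suc y) v x | +-suc m y | periodic y x = +-comm _ (f y x)

total-toSlots : (f : ℕ → A → ℕ) → (∀ h x → f (suc m + h) x ≡ f h x) →
  ∀ y (v : Vec A (suc m)) → total f 0 (toSlots y v) ≡ total f y v
total-toSlots f periodic y v =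
  trans (sym (total-fromSlots f periodic y (toSlots y v)))
        (cong (total f y) (fromSlots-toSlots y v))

All-∷ʳ⁺ : {P : A → Set} {v : Vec A m} {x : A} → All P v → P x → All P (v ∷ʳ x)
All-∷ʳ⁺ []       p = p ∷ []
All-∷ʳ⁺ (q ∷ qs) p = q ∷ All-∷ʳ⁺ qs p

All-∷ʳ⁻ : {P : A → Set} (v : Vec A m) {x : A} → All P (v ∷ʳ x) → All P v × P x
All-∷ʳ⁻ []      (p ∷ []) = [] , p
All-∷ʳ⁻ (_ ∷ v) (q ∷ qs) = let (ps , p) = All-∷ʳ⁻ v qs in q ∷ ps , p

All-fromSlots : {P : A → Set} → ∀ y {v : Vec A (suc m)} → All P v → All P (fromSlots y v)
All-fromSlots zero    ps = ps
All-fromSlots (suc y) {v} ps with fromSlots y v | All-fromSlots y ps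
... | _ ∷ _ | q ∷ qs = All-∷ʳ⁺ qs q

lookup-∷ʳ-inject₁ : (v : Vec A m) (x : A) (i : Fin m) → lookup (v ∷ʳ x) (inject₁ i) ≡ lookup v i
lookup-∷ʳ-inject₁ (_ ∷ v) x zero    = refl
lookup-∷ʳ-inject₁ (_ ∷ v) x (suc i) = lookup-∷ʳ-inject₁ v x i

lookup-∷ʳ-fromℕ : (v : Vec A m) (x : A) → lookup (v ∷ʳ x) (fromℕ m) ≡ x
lookup-∷ʳ-fromℕ []      x = refl
lookup-∷ʳ-fromℕ (_ ∷ v) x = lookup-∷ʳ-fromℕ v x

tabulate-∷ʳ : (f : Fin (suc m) → A) → tabulate f ≡ tabulate (f ∘ inject₁) ∷ʳ f (fromℕ m)
tabulate-∷ʳ {m = zero}  f = refl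
tabulate-∷ʳ {m = suc m} f = cong (f zero ∷_) (tabulate-∷ʳ (f ∘ suc))

------------------------------------------------------------------------
-- Peaks and double descents read from left to right

-- The peak heights of a word read from height h, where prev is the step
-- before it.  Remembering that step lets the peaks of a concatenation be
-- read factor by factor.
peaksFrom : ℕ → Step → ℤ → List Step → List ℤ
peaksFrom k prev h []      = []
peaksFrom k prev h (u ∷ w) = peaksFrom k u (h ℤ.+ 1ℤ) w
peaksFrom k u    h (d ∷ w) = h ∷ peaksFrom k d (h ℤ.- + k) w
peaksFrom k d    h (d ∷ w) = peaksFrom k d (h ℤ.- + k) w

-- A d step placed before the word creates no additional peak.
peakHeights-peaksFrom : ∀ k p w → peakHeights k p w ≡ peaksFrom k d (proj₂ p) w
peakHeights-peaksFrom k p []          = refl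
peakHeights-peaksFrom k p (u ∷ d ∷ w) = cong (_ ∷_) (peakHeights-peaksFrom k _ w)
peakHeights-peaksFrom k p (u ∷ u ∷ w) = peakHeights-peaksFrom k (move k p u) (u ∷ w)
peakHeights-peaksFrom k p (u ∷ [])    = refl
peakHeights-peaksFrom k p (d ∷ w)     = peakHeights-peaksFrom k (move k p d) w

-- The double descents of a word, including one formed with the previous step.
ddFrom : Step → List Step → ℕ
ddFrom prev []      = 0
ddFrom prev (u ∷ w) = ddFrom u w
ddFrom u    (d ∷ w) = ddFrom d w
ddFrom d    (d ∷ w) = suc (ddFrom d w)

dd-ddFrom : ∀ w → dd w ≡ ddFrom u w
dd-ddFrom []          = refl
dd-ddFrom (u ∷ w)     = dd-ddFrom w
dd-ddFrom (d ∷ [])    = refl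
dd-ddFrom (d ∷ u ∷ w) = dd-ddFrom w
dd-ddFrom (d ∷ d ∷ w) = cong suc (dd-ddFrom (d ∷ w))

dropLast-∷ʳ : (xs : List A) (x : A) → dropLast (xs List.∷ʳ x) ≡ xs
dropLast-∷ʳ []           x = refl
dropLast-∷ʳ (_ ∷ [])     x = refl
dropLast-∷ʳ (x′ ∷ y ∷ xs) x = cong (x′ ∷_) (dropLast-∷ʳ (y ∷ xs) x)

-- The number of heights in the list that are congruent to i modulo k.
congruent : ℕ → ℕ → List ℤ → ℕ
congruent k i hs = length (filter (λ h → h ≡? i mod k) hs)

congruent-++ : ∀ k i hs hs′ → congruent k i (hs ++ hs′) ≡ congruent k i hs + congruent k i hs′
congruent-++ k i hs hs′ =
  trans (cong length (List.filter-++ (λ h → h ≡? i mod k) hs hs′))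
        (List.length-++ (filter (λ h → h ≡? i mod k) hs))

congruent-yes : ∀ {k i h} → h ≡ i mod k → congruent k i (h ∷ []) ≡ 1
congruent-yes {k} {i} p = cong length (List.filter-accept (λ h → h ≡? i mod k) p)

congruent-no : ∀ {k i h} → ¬ h ≡ i mod k → congruent k i (h ∷ []) ≡ 0
congruent-no {k} {i} ¬p = cong length (List.filter-reject (λ h → h ≡? i mod k) ¬p)

congruent-periodic : ∀ k i y → congruent k i (+ (k + y) ∷ []) ≡ congruent k i (+ y ∷ [])
congruent-periodic k i y with (+ y) ≡? i mod k
... | yes p = trans (congruent-yes
  (subst (+ k ∣_) (sym (ℤ.+-assoc (+ k) (+ y) (ℤ.- + i))) (∣m∣n⇒∣m+n ∣-refl p)))
  (sym (congruent-yes p))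
... | no ¬p = trans (congruent-no λ q → ¬p
  (∣m+n∣m⇒∣n (subst (+ k ∣_) (ℤ.+-assoc (+ k) (+ y) (ℤ.- + i)) q) ∣-refl))
  (sym (congruent-no ¬p))

congruent-self : ∀ k i → congruent k i (+ i ∷ []) ≡ 1
congruent-self k i = congruent-yes {k} {i} {+ i} (divides 0ℤ (ℤ.+-inverseʳ (+ i)))

congruent-other : ∀ k i h → i < k → h < k → h ≢ i → congruent k i (+ h ∷ []) ≡ 0
congruent-other k i h i<k h<k h≢i = congruent-no λ p →
  apart (≤-total h i) (subst (λ z → k ∣ₙ ℤ.∣ z ∣) (ℤ.m-n≡m⊖n h i) (∣⇒∣ᵤ p))
  where
  apart : h ≤ i ⊎ i ≤ h → ¬ k ∣ₙ ℤ.∣ h ℤ.⊖ i ∣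
  apart (inj₁ h≤i) = subst (λ z → ¬ k ∣ₙ z) (sym (ℤ.∣⊖∣-≤ h≤i))
    (>⇒∤ {{>-nonZero (m<n⇒0<n∸m (≤∧≢⇒< h≤i h≢i))}} (≤-<-trans (m∸n≤m i h) i<k))
  apart (inj₂ i≤h) = subst (λ z → ¬ k ∣ₙ z)
    (sym (trans (ℤ.∣m⊖n∣≡∣n⊖m∣ h i) (ℤ.∣⊖∣-≤ i≤h)))
    (>⇒∤ {{>-nonZero (m<n⇒0<n∸m (≤∧≢⇒< i≤h (h≢i ∘ sym)))}} (≤-<-trans (m∸n≤m h i) h<k))

-- Paths and trees for the parameter k = j + 1.
module Correspondence (j : ℕ) where

  k : ℕ
  k = suc j

  ----------------------------------------------------------------------
  -- Trees and their words

  -- A possibly absent subtree; on the side of paths, a possibly empty factor.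
  Child : Set
  Child = Maybe (Tree (suc k))

  -- The tree of the path  v₀ u v₁ u ⋯ u x d  that starts at height y, where the
  -- factors v₀ , … , vₖ₋₁ are given in path order.
  build : ℕ → Vec Child k → Child → Tree (suc k)
  build y v x = node (toSlots y v ∷ʳ x)

  -- Induction on a tree whose base sits at height y, with the children of the
  -- root in path order.  The hypotheses are given at all heights, so that each
  -- use can choose the base height of the child.
  childInduction : (Q : Child → ℕ → Set) →
    (∀ y → Q nothing y) →
    (∀ y v x → All (λ x′ → ∀ z → Q x′ z) v → (∀ z → Q x z) → Q (just (build y v x)) y) →
    ∀ x y → Q x y
  childInduction Q base step = child
    where
    child    : ∀ x y → Q x y
    children : ∀ {m} (v : Vec Child m) → All (λ x → ∀ y → Q x y) v

    child nothing          y = base y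
    child (just (node cs)) y with initLast cs | children cs
    ... | v , x , refl | qs =
      let (qv , qx) = All-∷ʳ⁻ v qs in
      subst (λ v′ → Q (just (node (v′ ∷ʳ x))) y) (toSlots-fromSlots y v)
            (step y (fromSlots y v) x (All-fromSlots y qv) qx)

    children []      = []
    children (x ∷ v) = child x ∷ children v

  -- b₀ u b₁ u ⋯ bₘ₋₁ u, each block at its own base height.
  blocks : Vec (ℕ → List Step) m → ℕ → List Step
  blocks []       y = []
  blocks (b ∷ bs) y = b y ++ u ∷ blocks bs (suc y)

  -- The path of a tree with base height y.  Words of children are formed as
  -- functions of the height before being put in path order, which keeps the
  -- recursion structural.
  mutual

    word : Child → ℕ → List Step
    word nothing          y = []
    word (just (node cs)) y =
      blocks (fromSlots y (init (words cs))) y ++ last (words cs) (k + y) ++ d ∷ []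

    words : Vec Child m → Vec (ℕ → List Step) m
    words []      = []
    words (x ∷ v) = word x ∷ words v

  -- The word  v₀ u v₁ u ⋯ vₘ₋₁ u  from height y.
  forest : Vec Child m → ℕ → List Step
  forest v = blocks (map word v)

  words-map : (v : Vec Child m) → words v ≡ map word v
  words-map []      = refl
  words-map (x ∷ v) = cong (word x ∷_) (words-map v)

  word-build : ∀ y v x w →
    word (just (build y v x)) y ++ w ≡ forest v y ++ word x (k + y) ++ d ∷ w
  word-build y v x w
    rewrite words-map (toSlots y v ∷ʳ x)
          | Vec.map-∷ʳ word x (toSlots y v)
          | Vec.init-∷ʳ (word x) (map word (toSlots y v))
          | Vec.last-∷ʳ (word x) (map word (toSlots y v))
          | sym (map-fromSlots word y (toSlots y v))
          | fromSlots-toSlots y v =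
    trans (List.++-assoc (forest v y) _ w)
          (cong (forest v y ++_) (List.++-assoc (word x (k + y)) _ w))

  forest-∷ : ∀ x (v : Vec Child m) y w →
    forest (x ∷ v) y ++ w ≡ word x y ++ u ∷ forest v (suc y) ++ w
  forest-∷ x v y w = List.++-assoc (word x y) _ w

  ----------------------------------------------------------------------
  -- Statistics of trees

  -- The statistics e i and size, extended by 0 to the empty factor.
  eOf : Fin (suc k) → Child → ℕ
  eOf i nothing  = 0
  eOf i (just t) = e i t

  sizeOf : Child → ℕ
  sizeOf nothing  = 0
  sizeOf (just t) = size t

  es-total : ∀ i y (v : Vec Child m) → es i v ≡ total (λ _ → eOf i) y v
  es-total i y []            = refl
  es-total i y (nothing ∷ v) = es-total i (suc y) v
  es-total i y (just t ∷ v)  = cong (λ s → e i t + s) (es-total i (suc y) v)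

  sizes-total : ∀ y (v : Vec Child m) → sizes v ≡ total (λ _ → sizeOf) y v
  sizes-total y []            = refl
  sizes-total y (nothing ∷ v) = sizes-total (suc y) v
  sizes-total y (just t ∷ v)  = cong (λ s → size t + s) (sizes-total (suc y) v)

  total-build : (f : Child → ℕ) → ∀ y (v : Vec Child k) x →
    total (λ _ → f) 0 (toSlots y v ∷ʳ x) ≡ total (λ _ → f) y v + f x
  total-build f y v x = trans (total-∷ʳ (λ _ → f) 0 (toSlots y v) x)
    (cong (_+ f x) (total-toSlots (λ _ → f) (λ _ _ → refl) y v))

  size-build : ∀ y v x → size (build y v x) ≡ suc (total (λ _ → sizeOf) y v + sizeOf x)
  size-build y v x = cong suc (trans (sizes-total 0 (toSlots y v ∷ʳ x)) (total-build sizeOf y v x))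

  e-build-last : ∀ y v x → let i = fromℕ k in
    e i (build y v x) ≡ total (λ _ → eOf i) y v + (eOf i x + occupied x)
  e-build-last y v x = begin
    occupied (lookup (toSlots y v ∷ʳ x) i) + es i (toSlots y v ∷ʳ x)
      ≡⟨ cong₂ _+_ (cong occupied (lookup-∷ʳ-fromℕ (toSlots y v) x))
                   (trans (es-total i 0 (toSlots y v ∷ʳ x)) (total-build (eOf i) y v x)) ⟩
    occupied x + (total (λ _ → eOf i) y v + eOf i x)
      ≡⟨ trans (+-comm (occupied x) _) (+-assoc _ (eOf i x) (occupied x)) ⟩
    total (λ _ → eOf i) y v + (eOf i x + occupied x) ∎
    where
    open ≡-Reasoning
    i = fromℕ k

  -- The number of last peaks with residue i (0 or 1) in a factor with base
  -- height y: the height of the last peak is congruent to y.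
  lastPeak : ℕ → ℕ → Child → ℕ
  lastPeak i y nothing  = 0
  lastPeak i y (just _) = congruent k i (+ y ∷ [])

  -- The number of all peaks with residue i in a factor with base height y: one
  -- for each child in position i, and the last peak.
  peaksOf : Fin k → ℕ → Child → ℕ
  peaksOf i y x = eOf (inject₁ i) x + lastPeak (toℕ i) y x

  peaksOf-periodic : ∀ i y x → peaksOf i (k + y) x ≡ peaksOf i y x
  peaksOf-periodic i y nothing  = refl
  peaksOf-periodic i y (just t) = cong (λ s → _ + s) (congruent-periodic k (toℕ i) y)

  -- In slot order from height 0, the only height congruent to i is i itself.
  total-lastPeak : ∀ i (v : Vec Child k) →
    total (lastPeak (toℕ i)) 0 v ≡ occupied (lookup v i)
  total-lastPeak i v =
    trans (total-single (lastPeak (toℕ i)) 0 v i other) (self (lookup v i))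
    where
    other : ∀ h x → h < k + 0 → h ≢ toℕ i + 0 → lastPeak (toℕ i) h x ≡ 0
    other h nothing  _   _   = refl
    other h (just _) h<k h≢i = congruent-other k (toℕ i) h (toℕ<n i)
      (subst (h <_) (+-identityʳ k) h<k) λ h≡i → h≢i (trans h≡i (sym (+-identityʳ _)))

    self : ∀ x → lastPeak (toℕ i) (toℕ i + 0) x ≡ occupied x
    self nothing  = refl
    self (just _) rewrite +-identityʳ (toℕ i) = congruent-self k (toℕ i)

  e-build : ∀ i y v x →
    e (inject₁ i) (build y v x) ≡ total (peaksOf i) y v + eOf (inject₁ i) x
  e-build i y v x = begin
    occupied (lookup (s ∷ʳ x) i′) + es i′ (s ∷ʳ x)
      ≡⟨ cong₂ _+_ (cong occupied (lookup-∷ʳ-inject₁ s x i)) (es-total i′ 0 (s ∷ʳ x)) ⟩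
    occupied (lookup s i) + total (λ _ → eOf i′) 0 (s ∷ʳ x)
      ≡⟨ cong₂ _+_ (sym (total-lastPeak i s)) (total-∷ʳ (λ _ → eOf i′) 0 s x) ⟩
    total (lastPeak (toℕ i)) 0 s + (total (λ _ → eOf i′) 0 s + eOf i′ x)
      ≡⟨ swap (total (lastPeak (toℕ i)) 0 s) (total (λ _ → eOf i′) 0 s) (eOf i′ x) ⟩
    total (λ _ → eOf i′) 0 s + total (lastPeak (toℕ i)) 0 s + eOf i′ x
      ≡⟨ cong (_+ eOf i′ x) (sym (total-+ (λ _ → eOf i′) (lastPeak (toℕ i)) 0 s)) ⟩
    total (peaksOf i) 0 s + eOf i′ x
      ≡⟨ cong (_+ eOf i′ x) (total-toSlots (peaksOf i) (peaksOf-periodic i) y v) ⟩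
    total (peaksOf i) y v + eOf i′ x ∎
    where
    open ≡-Reasoning
    s  = toSlots y v
    i′ = inject₁ i

    swap : ∀ a b c → a + (b + c) ≡ b + a + c
    swap = solve-∀

  ----------------------------------------------------------------------
  -- Double descents

  -- The last step read after a factor, where prev was the step before it.
  lastStep : Child → Step → Step
  lastStep nothing  prev = prev
  lastStep (just _) prev = d

  -- In every context, the double descents that a factor contributes are as many
  -- as its last children.
  DDOf : Child → ℕ → Set
  DDOf x y = ∀ prev w →
    ddFrom prev (word x y ++ w) ≡ eOf (fromℕ k) x + ddFrom (lastStep x prev) w

  -- A nonempty forest ends with u, whichever step comes before it.
  dd-forest : (v : Vec Child (suc m)) → All (λ x → ∀ y → DDOf x y) v → ∀ y prev w →
    ddFrom prev (forest v y ++ w) ≡ total (λ _ → eOf (fromℕ k)) y v + ddFrom u w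
  dd-forest (x ∷ v) (q ∷ qs) y prev w
    rewrite forest-∷ x v y w | q y prev (u ∷ forest v (suc y) ++ w) =
    trans (cong (λ s → eOf (fromℕ k) x + s) (remaining v qs)) (sym (+-assoc (eOf (fromℕ k) x) _ _))
    where
    remaining : ∀ {m} (v : Vec Child m) → All (λ x → ∀ y → DDOf x y) v →
      ddFrom u (forest v (suc y) ++ w) ≡ total (λ _ → eOf (fromℕ k)) (suc y) v + ddFrom u w
    remaining []        qs = refl
    remaining (x′ ∷ v′) qs = dd-forest (x′ ∷ v′) qs (suc y) u w

  dd-word : ∀ x y → DDOf x y
  dd-word = childInduction DDOf (λ _ _ _ → refl) step
    where
    step : ∀ y v x → All (λ x′ → ∀ z → DDOf x′ z) v → (∀ z → DDOf x z) → DDOf (just (build y v x)) y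
    step y v x qs q prev w
      rewrite word-build y v x w
            | dd-forest v qs y prev (word x (k + y) ++ d ∷ w)
            | q (k + y) u (d ∷ w)
            | e-build-last y v x =
        trans (cong (λ s → total f y v + s) (final x)) (sym (+-assoc (total f y v) _ _))
      where
      f : ℕ → Child → ℕ
      f _ = eOf (fromℕ k)

      -- The final d follows u if x is empty and d otherwise.
      final : ∀ x → eOf (fromℕ k) x + ddFrom (lastStep x u) (d ∷ w) ≡
                    eOf (fromℕ k) x + occupied x + ddFrom d w
      final nothing  = refl
      final (just t) = sym (+-assoc (e (fromℕ k) t) 1 _)

  ----------------------------------------------------------------------
  -- Peaks

  -- What is claimed of the peak heights hs of a factor with base height y: there
  -- are none if it is empty; otherwise e counts those before the last one by
  -- residue, and the last one has the residue of y.
  LastPeak : Child → ℕ → List ℤ → Set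
  LastPeak nothing  y hs = hs ≡ []
  LastPeak (just t) y hs = ∃₂ λ hs′ h → hs ≡ hs′ List.∷ʳ h ×
    (∀ (i : Fin k) → congruent k (toℕ i) hs′ ≡ e (inject₁ i) t) ×
    (∀ i → congruent k i (h ∷ []) ≡ congruent k i (+ y ∷ []))

  -- A list of heights as above that the factor contributes in every context.
  PeaksOf : Child → ℕ → Set
  PeaksOf x y = ∃[ hs ] LastPeak x y hs × (∀ prev w →
    peaksFrom k prev (+ y) (word x y ++ w) ≡ hs ++ peaksFrom k (lastStep x prev) (+ y) w)

  congruent-LastPeak : ∀ i x y {hs} → LastPeak x y hs → congruent k (toℕ i) hs ≡ peaksOf i y x
  congruent-LastPeak i nothing  y refl = refl
  congruent-LastPeak i (just t) y (hs′ , h , refl , count , residue) =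
    trans (congruent-++ k (toℕ i) hs′ (h ∷ [])) (cong₂ _+_ (count i) (residue (toℕ i)))

  peaks-forest : (v : Vec Child (suc m)) → All (λ x → ∀ y → PeaksOf x y) v → ∀ y →
    ∃[ hs ] (∀ i → congruent k (toℕ i) hs ≡ total (peaksOf i) y v) × (∀ prev w →
      peaksFrom k prev (+ y) (forest v y ++ w) ≡ hs ++ peaksFrom k u (+ (suc m + y)) w)
  peaks-forest {m = m} (x ∷ v) (q ∷ qs) y =
    let (hs , last-hs , eq) = q y
        (hs′ , count , eq′) = remaining v qs
    in hs ++ hs′
     , (λ i → trans (congruent-++ k (toℕ i) hs hs′)
                    (cong₂ _+_ (congruent-LastPeak i x y last-hs) (count i)))
     , λ prev w → begin
         peaksFrom k prev (+ y) (forest (x ∷ v) y ++ w)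
           ≡⟨ cong (peaksFrom k prev (+ y)) (forest-∷ x v y w) ⟩
         peaksFrom k prev (+ y) (word x y ++ u ∷ forest v (suc y) ++ w)
           ≡⟨ eq prev (u ∷ forest v (suc y) ++ w) ⟩
         hs ++ peaksFrom k u (+ (y + 1)) (forest v (suc y) ++ w)
           ≡⟨ cong (λ h → hs ++ peaksFrom k u (+ h) (forest v (suc y) ++ w)) (+-comm y 1) ⟩
         hs ++ peaksFrom k u (+ suc y) (forest v (suc y) ++ w)
           ≡⟨ cong (hs ++_) (eq′ w) ⟩
         hs ++ hs′ ++ peaksFrom k u (+ (m + suc y)) w
           ≡⟨ sym (List.++-assoc hs hs′ _) ⟩
         (hs ++ hs′) ++ peaksFrom k u (+ (m + suc y)) w
           ≡⟨ cong (λ h → (hs ++ hs′) ++ peaksFrom k u (+ h) w) (+-suc m y) ⟩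
         (hs ++ hs′) ++ peaksFrom k u (+ suc (m + y)) w ∎
    where
    open ≡-Reasoning

    remaining : ∀ {m} (v : Vec Child m) → All (λ x → ∀ y → PeaksOf x y) v →
      ∃[ hs ] (∀ i → congruent k (toℕ i) hs ≡ total (peaksOf i) (suc y) v) × (∀ w →
        peaksFrom k u (+ suc y) (forest v (suc y) ++ w) ≡ hs ++ peaksFrom k u (+ (m + suc y)) w)
    remaining []        qs = [] , (λ _ → refl) , λ _ → refl
    remaining (x′ ∷ v′) qs =
      let (hs , count , eq) = peaks-forest (x′ ∷ v′) qs (suc y) in hs , count , eq u

  descent : ∀ y → + (k + y) ℤ.- + k ≡ + y
  descent y = trans (ℤ.m-n≡m⊖n (k + y) k) (trans (ℤ.⊖-≥ (m≤m+n k y)) (cong +_ (m+n∸m≡n k y)))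

  peaks-word : ∀ x y → PeaksOf x y
  peaks-word = childInduction PeaksOf (λ _ → [] , refl , λ _ _ → refl) step
    where
    open ≡-Reasoning

    step : ∀ y v x → All (λ x′ → ∀ z → PeaksOf x′ z) v → (∀ z → PeaksOf x z) →
      PeaksOf (just (build y v x)) y
    step y v x qs q =
      let (hs , count , eq)    = peaks-forest v qs y
          (hs′ , last-hs′ , eq′) = q (k + y)
          (hs″ , last-hs″ , eq″) = finish x hs hs′ count last-hs′
      in hs″ , last-hs″ , λ prev w → begin
        peaksFrom k prev (+ y) (word (just (build y v x)) y ++ w)
          ≡⟨ cong (peaksFrom k prev (+ y)) (word-build y v x w) ⟩
        peaksFrom k prev (+ y) (forest v y ++ word x (k + y) ++ d ∷ w)
          ≡⟨ eq prev _ ⟩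
        hs ++ peaksFrom k u (+ (k + y)) (word x (k + y) ++ d ∷ w)
          ≡⟨ cong (hs ++_) (eq′ u (d ∷ w)) ⟩
        hs ++ hs′ ++ peaksFrom k (lastStep x u) (+ (k + y)) (d ∷ w)
          ≡⟨ eq″ w ⟩
        hs″ ++ peaksFrom k d (+ (k + y) ℤ.- + k) w
          ≡⟨ cong (λ h → hs″ ++ peaksFrom k d h w) (descent y) ⟩
        hs″ ++ peaksFrom k d (+ y) w ∎
      where
      -- The last peak is the one closed by the final d if x is empty, and the last
      -- peak of x otherwise.
      finish : ∀ x hs hs′ → (∀ i → congruent k (toℕ i) hs ≡ total (peaksOf i) y v) →
        LastPeak x (k + y) hs′ → ∃[ hs″ ] LastPeak (just (build y v x)) y hs″ × (∀ w →
          hs ++ hs′ ++ peaksFrom k (lastStep x u) (+ (k + y)) (d ∷ w) ≡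
          hs″ ++ peaksFrom k d (+ (k + y) ℤ.- + k) w)
      finish nothing hs hs′ count refl =
        hs List.∷ʳ + (k + y) ,
        (hs , + (k + y) , refl ,
          (λ i → trans (count i) (sym (trans (e-build i y v nothing) (+-identityʳ _)))) ,
          (λ i → congruent-periodic k i y)) ,
        λ w → sym (List.++-assoc hs _ _)
      finish (just t) hs hs′ count (hs₁ , h , refl , count₁ , residue) =
        hs ++ hs₁ List.∷ʳ h ,
        (hs ++ hs₁ , h , sym (List.++-assoc hs hs₁ _) ,
          (λ i → trans (congruent-++ k (toℕ i) hs hs₁)
            (trans (cong₂ _+_ (count i) (count₁ i)) (sym (e-build i y v (just t))))) ,
          (λ i → trans (residue i) (congruent-periodic k i y))) ,
        λ w → sym (List.++-assoc hs _ _)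

  pk-word : ∀ t i → pk k (toℕ i) (word (just t) 0) ≡ e (inject₁ i) t
  pk-word t i with peaks-word (just t) 0
  ... | hs , (hs′ , h , refl , count , _) , eq =
    trans (cong (congruent k (toℕ i)) (trans (cong dropLast peaks) (dropLast-∷ʳ hs′ h))) (count i)
    where
    w = word (just t) 0
    peaks : peakHeights k origin w ≡ hs
    peaks = begin
      peakHeights k origin w      ≡⟨ peakHeights-peaksFrom k origin w ⟩
      peaksFrom k d 0ℤ w          ≡⟨ cong (peaksFrom k d 0ℤ) (sym (List.++-identityʳ w)) ⟩
      peaksFrom k d 0ℤ (w ++ [])  ≡⟨ eq d [] ⟩
      hs ++ []                    ≡⟨ List.++-identityʳ hs ⟩
      hs                          ∎
      where open ≡-Reasoning

  statistics-word : ∀ t → pathStatistics k (word (just t) 0) ≡ treeStatistics t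
  statistics-word t = trans
    (cong₂ _∷ʳ_ (Vec.tabulate-cong (pk-word t)) dds)
    (sym (tabulate-∷ʳ (λ i → e i t)))
    where
    w = word (just t) 0
    dds : dd w ≡ e (fromℕ k) t
    dds = begin
      dd w                 ≡⟨ dd-ddFrom w ⟩
      ddFrom u w           ≡⟨ cong (ddFrom u) (sym (List.++-identityʳ w)) ⟩
      ddFrom u (w ++ [])   ≡⟨ dd-word (just t) 0 u [] ⟩
      e (fromℕ k) t + 0    ≡⟨ +-identityʳ _ ⟩
      e (fromℕ k) t        ∎
      where open ≡-Reasoning

  ----------------------------------------------------------------------
  -- Words of trees are Dyck paths

  -- Remainder y w: starting at height y, the word w ends at height 0 and never
  -- goes below it.
  data Remainder : ℕ → List Step → Set where
    stop : Remainder 0 []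
    up   : ∀ {y w} → Remainder (suc y) w → Remainder y (u ∷ w)
    down : ∀ {y w} → Remainder y w → Remainder (k + y) (d ∷ w)

  remainder-sound : ∀ {y w} → Remainder y w → ∀ x →
    ListAll.All InFirstQuadrant (vertices k (+ x , + y) w) ×
    foldl (move k) (+ x , + y) w ≡ (+ (x + length w) , 0ℤ)
  remainder-sound stop x =
    (+≤+ z≤n , +≤+ z≤n) ∷ [] , cong (λ z → + z , 0ℤ) (sym (+-identityʳ x))
  remainder-sound {y} {u ∷ w} (up r) x with remainder-sound r (suc x)
  ... | above , end rewrite +-comm x 1 | +-comm y 1 | +-suc x (length w) =
    (+≤+ z≤n , +≤+ z≤n) ∷ above , end
  remainder-sound {_} {d ∷ w} (down {y} r) x with remainder-sound r (suc x)
  ... | above , end rewrite +-comm x 1 | descent y | +-suc x (length w) =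
    (+≤+ z≤n , +≤+ z≤n) ∷ above , end

  remainder-complete : ∀ w x y → ListAll.All InFirstQuadrant (vertices k (x , + y) w) →
    proj₂ (foldl (move k) (x , + y) w) ≡ 0ℤ → Remainder y w
  remainder-complete []      x y _           refl = stop
  remainder-complete (u ∷ w) x y (_ ∷ above) end
    rewrite +-comm y 1 = up (remainder-complete w _ (suc y) above end)
  remainder-complete (d ∷ w) x y (_ ∷ above) end =
    subst (λ z → Remainder z (d ∷ w)) (m+[n∸m]≡n k≤y)
      (down (remainder-complete w (x ℤ.+ 1ℤ) (y ∸ k)
        (subst (λ h → ListAll.All InFirstQuadrant (vertices k (x ℤ.+ 1ℤ , h) w)) lower above)
        (subst (λ h → proj₂ (foldl (move k) (x ℤ.+ 1ℤ , h) w) ≡ 0ℤ) lower end)))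
    where
    start : ∀ {p} w → ListAll.All InFirstQuadrant (vertices k p w) → InFirstQuadrant p
    start []      (p ∷ _) = p
    start (_ ∷ _) (p ∷ _) = p

    k≤y : k ≤ y
    k≤y = ℤ.drop‿+≤+ (ℤ.0≤i-j⇒j≤i (proj₂ (start w above)))

    lower : + y ℤ.- + k ≡ + (y ∸ k)
    lower = trans (ℤ.m-n≡m⊖n y k) (ℤ.⊖-≥ k≤y)

  remainder⇒dyck : ∀ n {w} → Remainder 0 w → length w ≡ suc k * n → IsDyckPath k n w
  remainder⇒dyck n r len =
    let (above , end) = remainder-sound r 0 in above , trans end (cong (λ l → + l , 0ℤ) len)

  dyck⇒remainder : ∀ n w → IsDyckPath k n w → Remainder 0 w
  dyck⇒remainder n w (above , end) = remainder-complete w 0ℤ 0 above (cong proj₂ end)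

  dyck-length : ∀ n w → IsDyckPath k n w → length w ≡ suc k * n
  dyck-length n w p = ℤ.+-injective (cong proj₁
    (trans (sym (proj₂ (remainder-sound (dyck⇒remainder n w p) 0))) (proj₂ p)))

  -- Inserting the factor at height y keeps a word from going below height 0.
  RemainderOf : Child → ℕ → Set
  RemainderOf x y = ∀ w → Remainder y w → Remainder y (word x y ++ w)

  remainder-forest : (v : Vec Child m) → All (λ x → ∀ y → RemainderOf x y) v → ∀ y w →
    Remainder (m + y) w → Remainder y (forest v y ++ w)
  remainder-forest []      []       y w r = r
  remainder-forest {m = suc m} (x ∷ v) (q ∷ qs) y w r rewrite forest-∷ x v y w =
    q y _ (up (remainder-forest v qs (suc y) w (subst (λ h → Remainder h w) (sym (+-suc m y)) r)))

  remainder-word : ∀ x y → RemainderOf x y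
  remainder-word = childInduction RemainderOf (λ _ _ r → r) λ y v x qs q w r →
    subst (Remainder y) (sym (word-build y v x w))
      (remainder-forest v qs y _ (q (k + y) (d ∷ w) (down r)))

  -- A factor has k + 1 steps for each node.
  LengthOf : Child → ℕ → Set
  LengthOf x y = ∀ w → length (word x y ++ w) ≡ suc k * sizeOf x + length w

  length-forest : (v : Vec Child m) → All (λ x → ∀ y → LengthOf x y) v → ∀ y w →
    length (forest v y ++ w) ≡ m + suc k * total (λ _ → sizeOf) y v + length w
  length-forest []      []       y w = cong (_+ length w) (sym (*-zeroʳ k))
  length-forest {m = suc m} (x ∷ v) (q ∷ qs) y w
    rewrite forest-∷ x v y w
          | q y (u ∷ forest v (suc y) ++ w)
          | length-forest v qs (suc y) w =
    collect (suc k) m (sizeOf x) (total (λ _ → sizeOf) (suc y) v) (length w)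
    where
    collect : ∀ l m a b c → l * a + suc (m + l * b + c) ≡ suc m + l * (a + b) + c
    collect = solve-∀

  length-word : ∀ x y → LengthOf x y
  length-word = childInduction LengthOf (λ _ w → cong (_+ length w) (sym (*-zeroʳ k))) step
    where
    step : ∀ y v x → All (λ x′ → ∀ z → LengthOf x′ z) v → (∀ z → LengthOf x z) →
      LengthOf (just (build y v x)) y
    step y v x qs q w = begin
      length (word (just (build y v x)) y ++ w)
        ≡⟨ cong length (word-build y v x w) ⟩
      length (forest v y ++ word x (k + y) ++ d ∷ w)
        ≡⟨ length-forest v qs y _ ⟩
      k + suc k * T + length (word x (k + y) ++ d ∷ w)
        ≡⟨ cong (λ l → k + suc k * T + l) (q (k + y) (d ∷ w)) ⟩
      k + suc k * T + (suc k * sizeOf x + suc (length w))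
        ≡⟨ collect k T (sizeOf x) (length w) ⟩
      suc k * suc (T + sizeOf x) + length w
        ≡⟨ cong (λ s → suc k * s + length w) (sym (size-build y v x)) ⟩
      suc k * size (build y v x) + length w ∎
      where
      open ≡-Reasoning
      T = total (λ _ → sizeOf) y v
      collect : ∀ k a b c → k + suc k * a + (suc k * b + suc c) ≡ suc k * suc (a + b) + c
      collect = solve-∀

  length-tree : ∀ t → length (word (just t) 0) ≡ suc k * size t
  length-tree t = trans (cong length (sym (List.++-identityʳ (word (just t) 0))))
    (trans (length-word (just t) 0 []) (+-identityʳ _))

  word-dyck : ∀ {n} t → size t ≡ n → IsDyckPath k n (word (just t) 0)
  word-dyck t refl = remainder⇒dyck (size t)
    (subst (Remainder 0) (List.++-identityʳ (word (just t) 0)) (remainder-word (just t) 0 [] stop))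
    (length-tree t)

  ----------------------------------------------------------------------
  -- Parsing

  -- A stack lists factors of the path read so far, topmost first; a factor with
  -- h entries beneath it has base height h.  pop takes the top m entries off
  -- and returns them in path order.  Below its bottom the stack is padded with
  -- empty factors, which are never reached on a Dyck path.
  pop : ∀ m → List Child → Vec Child m × List Child
  pop zero    st       = [] , st
  pop (suc m) []       = replicate (suc m) nothing , []
  pop (suc m) (x ∷ st) = let (v , st′) = pop m st in v ∷ʳ x , st′

  -- Puts the entries of a vector in path order onto a stack.
  push : List Child → Vec Child m → List Child
  push st []      = st
  push st (x ∷ v) = push (x ∷ st) v

  push-∷ʳ : ∀ st (v : Vec Child m) x → push st (v ∷ʳ x) ≡ x ∷ push st v
  push-∷ʳ st []       x = refl
  push-∷ʳ st (x′ ∷ v) x = push-∷ʳ (x′ ∷ st) v x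

  length-push : ∀ st (v : Vec Child m) → length (push st v) ≡ m + length st
  length-push st []                = refl
  length-push {m = suc m} st (x ∷ v) = trans (length-push (x ∷ st) v) (+-suc m (length st))

  pop-push : ∀ st (v : Vec Child m) → pop m (push st v) ≡ (v , st)
  pop-push {m = zero}  st [] = refl
  pop-push {m = suc m} st v with initLast v
  ... | v′ , x , refl rewrite push-∷ʳ st v′ x | pop-push st v′ = refl

  push-pop : ∀ m {y} st → length st ≡ m + y →
    let (v , st′) = pop m st in push st′ v ≡ st × length st′ ≡ y
  push-pop zero    st       eq = refl , eq
  push-pop (suc m) (x ∷ st) eq =
    let (eq₁ , eq₂) = push-pop m st (suc-injective eq)
        (v , st′)   = pop m st
    in trans (push-∷ʳ st′ v x) (cong (x ∷_) eq₁) , eq₂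

  -- A shift-reduce parser, where x is the factor that ends at the current point.
  -- The step u shifts x onto the stack, and d reduces x and the k topmost
  -- entries to one factor.
  parse : List Child → Child → List Step → Child
  parse st x []      = x
  parse st x (u ∷ w) = parse (x ∷ st) nothing w
  parse st x (d ∷ w) = let (v , st′) = pop k st in parse st′ (just (build (length st′) v x)) w

  -- The word read before the current factor.
  stackWord : List Child → List Step
  stackWord []       = []
  stackWord (x ∷ st) = stackWord st ++ word x (length st) ++ u ∷ []

  stackWord-∷ : ∀ x st w → stackWord (x ∷ st) ++ w ≡ stackWord st ++ word x (length st) ++ u ∷ w
  stackWord-∷ x st w = trans (List.++-assoc (stackWord st) _ w)
    (cong (stackWord st ++_) (List.++-assoc (word x (length st)) _ w))

  stackWord-push : ∀ st (v : Vec Child m) w →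
    stackWord (push st v) ++ w ≡ stackWord st ++ forest v (length st) ++ w
  stackWord-push st []      w = refl
  stackWord-push st (x ∷ v) w = trans (stackWord-push (x ∷ st) v w)
    (trans (stackWord-∷ x st (forest v (suc (length st)) ++ w))
           (cong (stackWord st ++_) (sym (forest-∷ x v (length st) w))))

  -- Parsing loses nothing: the word of the result is what was read before,
  -- the current factor and the unread word.
  word-parse-from : ∀ {y w} → Remainder y w → ∀ st x → length st ≡ y →
    word (parse st x w) 0 ≡ stackWord st ++ word x y ++ w
  word-parse-from stop [] x refl = sym (List.++-identityʳ (word x 0))
  word-parse-from {w = u ∷ w} (up r) st x refl =
    trans (word-parse-from r (x ∷ st) nothing refl) (stackWord-∷ x st w)
  word-parse-from {w = d ∷ w} (down {y} r) st x eq
    with pop k st | push-pop k st eq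
  ... | v , st′ | refl , refl = begin
    word (parse st′ (just (build y v x)) w) 0
      ≡⟨ word-parse-from r st′ (just (build y v x)) refl ⟩
    stackWord st′ ++ word (just (build y v x)) y ++ w
      ≡⟨ cong (stackWord st′ ++_) (word-build y v x w) ⟩
    stackWord st′ ++ forest v y ++ word x (k + y) ++ d ∷ w
      ≡⟨ sym (stackWord-push st′ v _) ⟩
    stackWord (push st′ v) ++ word x (k + y) ++ d ∷ w ∎
    where open ≡-Reasoning

  -- Reading the word of x at the height of the stack makes x the current factor.
  ParseOf : Child → ℕ → Set
  ParseOf x y = ∀ st w → length st ≡ y → parse st nothing (word x y ++ w) ≡ parse st x w

  parse-forest : (v : Vec Child m) → All (λ x → ∀ y → ParseOf x y) v → ∀ y st w → length st ≡ y →
    parse st nothing (forest v y ++ w) ≡ parse (push st v) nothing w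
  parse-forest []      []       y st w eq = refl
  parse-forest (x ∷ v) (q ∷ qs) y st w eq
    rewrite forest-∷ x v y w | q y st (u ∷ forest v (suc y) ++ w) eq =
    parse-forest v qs (suc y) (x ∷ st) w (cong suc eq)

  parse-word-onto : ∀ x y → ParseOf x y
  parse-word-onto = childInduction ParseOf (λ _ _ _ _ → refl) step
    where
    step : ∀ y v x → All (λ x′ → ∀ z → ParseOf x′ z) v → (∀ z → ParseOf x z) →
      ParseOf (just (build y v x)) y
    step y v x qs q st w refl
      rewrite word-build y v x w
            | parse-forest v qs y st (word x (k + y) ++ d ∷ w) refl
            | q (k + y) (push st v) (d ∷ w) (length-push st v)
            | pop-push st v = refl

  -- The default value for words that parse to the empty factor.
  leaf : Tree (suc k)
  leaf = node (replicate (suc k) nothing)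

  -- The inverse of word at height 0.
  treeOf : List Step → Tree (suc k)
  treeOf w = fromMaybe leaf (parse [] nothing w)

  treeOf-word : ∀ t → treeOf (word (just t) 0) ≡ t
  treeOf-word t = cong (fromMaybe leaf) (trans
    (cong (parse [] nothing) (sym (List.++-identityʳ (word (just t) 0))))
    (parse-word-onto (just t) 0 [] [] refl))

  word-treeOf : ∀ {n w} → n ≥ 1 → IsDyckPath k n w → word (just (treeOf w)) 0 ≡ w
  word-treeOf {suc n} {w} _ p
    with parse [] nothing w | word-parse-from (dyck⇒remainder (suc n) w p) [] nothing refl
  ... | just t  | eq   = eq
  ... | nothing | refl with () ← dyck-length (suc n) [] p

  size-treeOf : ∀ {n w} → n ≥ 1 → IsDyckPath k n w → size (treeOf w) ≡ n
  size-treeOf {n} {w} n≥1 p = *-cancelˡ-≡ _ n (suc k) (trans (sym (length-tree (treeOf w)))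
    (trans (cong length (word-treeOf n≥1 p)) (dyck-length n w p)))

  ----------------------------------------------------------------------
  -- The bijection

  module _ {n : ℕ} (n≥1 : n ≥ 1) (r : Vec ℕ (suc k)) where

    Path : List Step → Set
    Path w = IsDyckPath k n w × pathStatistics k w ≡ r

    -- Refinements keep their proofs irrelevant; this decision procedure recovers a
    -- proof that can be used.
    Path? : Decidable Path
    Path? w =
      (ListAll.all? (λ p → (0ℤ ℤ.≤? proj₁ p) ×-dec (0ℤ ℤ.≤? proj₂ p)) (vertices k origin w)
        ×-dec Product.≡-dec ℤ._≟_ ℤ._≟_ _ _)
      ×-dec Vec.≡-dec _≟_ _ r

    paths-flat : [ P ∈ DyckPath k n ∣ pathStatistics k (value P) ≡ r ] ↔ [ w ∈ List Step ∣ Path w ]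
    paths-flat = mk↔ₛ′
      (λ where ((w , [ p ]) , [ q ]) → w , [ p , q ])
      (λ where (w , [ pq ]) → (w , [ proj₁ pq ]) , [ proj₂ pq ])
      (λ _ → refl) (λ _ → refl)

    trees↔paths : [ T ∈ TreeOfSize (suc k) n ∣ treeStatistics (value T) ≡ r ] ↔
                  [ w ∈ List Step ∣ Path w ]
    trees↔paths = mk↔ₛ′
      (λ where ((t , [ p ]) , [ q ]) →
                 word (just t) 0 , [ word-dyck t p , trans (statistics-word t) q ])
      (λ where (w , [ pq ]) →
                 (treeOf w , [ size-treeOf n≥1 (proj₁ pq) ]) ,
                 [ trans (sym (statistics-word (treeOf w)))
                         (trans (cong (pathStatistics k) (word-treeOf n≥1 (proj₁ pq))) (proj₂ pq)) ])
      (λ where (w , [ pq ]) → value-injective (word-treeOf n≥1 (proj₁ (recompute (Path? w) pq))))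
      (λ where ((t , [ _ ]) , [ _ ]) → value-injective (value-injective (treeOf-word t)))

    equidistributed : ∃[ N ]
      (HasCardinality [ P ∈ DyckPath k n ∣ pathStatistics k (value P) ≡ r ] N ×
       HasCardinality [ T ∈ TreeOfSize (suc k) n ∣ treeStatistics (value T) ≡ r ] N)
    equidistributed =
      let (N , paths↔Fin) = words-finite Path? (suc k * n) (λ {w} → dyck-length n w ∘ proj₁)
      in N , paths↔Fin ↔-∘ paths-flat , paths↔Fin ↔-∘ trees↔paths

theorem2p7 : (k n : ℕ) → k ≥ 1 → n ≥ 1 → (r : Vec ℕ (suc k)) →
    ∃[ N ] (HasCardinality [ P ∈ DyckPath k n ∣ pathStatistics k (value P) ≡ r ] N ×
    HasCardinality [ T ∈ TreeOfSize (suc k) n ∣ treeStatistics (value T) ≡ r ] N)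
theorem2p7 (suc j) n _ n≥1 r = Correspondence.equidistributed j n≥1 r
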